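{- Let $\lambda$ be a nonzero real number and let $n,r$ be positive integers. Then $$H_{n,\lambda}^{(r)}=\frac{1}{n!}\sum_{k=1}^{n}(-1)^{n-k}\langle r\rangle_{k-1,\lambda}\,k\,S_{1,\lambda}(n,k).$$ In particular, for $r=1$, $$H_{n,\lambda}=\frac{1}{n!}\sum_{k=1}^{n}(-1)^{n-k}k\,\langle 1\rangle_{k-1,\lambda}S_{1,\lambda}(n,k).$$
   Context: For real $x$ and integer $k\ge0$: $(x)_{0,\lambda}=1$, $(x)_{k,\lambda}=x(x-\lambda)\cdots(x-(k-1)\lambda)$; $\langle x\rangle_{0,\lambda}=1$, $\langle x\rangle_{k,\lambda}=x(x+\lambda)\cdots(x+(k-1)\lambda)$; $(x)_0=1$, $(x)_k=x(x-1)\cdots(x-k+1)$. The degenerate Stirling numbers of the first kind $S_{1,\lambda}(n,k)$ are defined by $(x)_{n}=\sum_{k=0}^{n}S_{1,\lambda}(n,k)(x)_{k,\lambda}$ for $n\ge 0$; equivalently $\frac{1}{k!}(\log_\lambda(1+t))^k=\sum_{n\ge k}S_{1,\lambda}(n,k)\frac{t^n}{n!}$ with $\log_\lambda(1+t)=\sum_{k\ge1}\lambda^{k-1}(1)_{k,1/\lambda}t^k/k!=((1+t)^\lambda-1)/\lambda$. The degenerate harmonic numbers are $H_{0,\lambda}=0$, $H_{n,\lambda}=\sum_{k=1}^{n}\frac{1}{\lambda}\binom{\lambda}{k}(-1)^{k-1}$ for $n\ge1$; the degenerate hyperharmonic numbers are $H_{n,\lambda}^{(1)}=H_{n,\lambda}$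 and $H_{n,\lambda}^{(r)}=\sum_{k=1}^{n}H_{k,\lambda}^{(r-1)}$ for $r\ge2$. -}

module Defs where

open import Algebra.Apartness.Bundles using (HeytingField)
open import Algebra.Bundles using (CommutativeRing)
open import Data.Fin.Base using (toℕ)
open import Data.Integer.Base using (+_)
open import Data.Nat.Base as ℕ using (ℕ; zero; suc; _!; _∸_; NonZero)
import Data.Nat.Properties as ℕₚ
open import Data.Product.Base using (_×_; _,_; ∃-syntax)
open import Data.Rational.Base as ℚ using (ℚ; 0ℚ; 1ℚ; ½; ∣_∣)
import Data.Rational.Properties as ℚₚ
open import Data.Rational.Solver using (module +-*-Solver)
open import Data.Sum.Base using (_⊎_; inj₁; inj₂)
open import Level using (0ℓ)
open import Relation.Binary.PropositionalEquality.Core as ≡ using (_≡_; _≢_)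
open import Relation.Binary.PropositionalEquality.Properties using (module ≡-Reasoning)
open import Relation.Nullary.Decidable.Core using (Dec; yes; no)
open import Relation.Nullary.Negation.Core using (¬_; contradiction)

private
  opaque
    triangle : ∀ p q r → ∣ p ℚ.- r ∣ ℚ.≤ ∣ p ℚ.- q ∣ ℚ.+ ∣ q ℚ.- r ∣
    triangle p q r = ≡.subst (λ t → ∣ t ∣ ℚ.≤ ∣ p ℚ.- q ∣ ℚ.+ ∣ q ℚ.- r ∣) eq
      (ℚₚ.∣p+q∣≤∣p∣+∣q∣ (p ℚ.- q) (q ℚ.- r))
      where
      open +-*-Solver
      eq : (p ℚ.- q) ℚ.+ (q ℚ.- r) ≡ p ℚ.- r
      eq = solve 3 (λ a b c → (a :- b) :+ (b :- c) := a :- c) ≡.refl p q r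

    ∣-∣-swap : ∀ p q → ∣ p ℚ.- q ∣ ≡ ∣ q ℚ.- p ∣
    ∣-∣-swap p q = ≡.trans (≡.sym (ℚₚ.∣-p∣≡∣p∣ (p ℚ.- q))) (≡.cong ∣_∣ eq)
      where
      open +-*-Solver
      eq : ℚ.- (p ℚ.- q) ≡ q ℚ.- p
      eq = solve 2 (λ a b → :- (a :- b) := b :- a) ≡.refl p q

    p-0≡p : ∀ p → p ℚ.- 0ℚ ≡ p
    p-0≡p p = ℚₚ.+-identityʳ p

    ∣p-p∣≡0 : ∀ p → ∣ p ℚ.- p ∣ ≡ 0ℚ
    ∣p-p∣≡0 p = ≡.cong ∣_∣ (ℚₚ.+-inverseʳ p)

    0<1 : 0ℚ ℚ.< 1ℚ
    0<1 = ℚₚ.positive⁻¹ 1ℚ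

    +-pos : ∀ {p q} → 0ℚ ℚ.< p → 0ℚ ℚ.< q → 0ℚ ℚ.< p ℚ.+ q
    +-pos 0<p 0<q = ℚₚ.+-mono-< 0<p 0<q

    *-pos : ∀ {p q} → 0ℚ ℚ.< p → 0ℚ ℚ.< q → 0ℚ ℚ.< p ℚ.* q
    *-pos {p} {q} 0<p 0<q = ≡.subst (ℚ._< p ℚ.* q) (ℚₚ.*-zeroʳ p)
      (ℚₚ.*-monoʳ-<-pos p {{ℚ.positive 0<p}} 0<q)

    divide : ∀ c ε → 0ℚ ℚ.< c → 0ℚ ℚ.< ε → ∃[ δ ] 0ℚ ℚ.< δ × c ℚ.* δ ≡ ε
    divide c ε 0<c 0<ε = c⁻¹ ℚ.* ε , *-pos 0<c⁻¹ 0<ε , eq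
      where
      instance
        c>0 : ℚ.Positive c
        c>0 = ℚ.positive 0<c
        c≢0 : ℚ.NonZero c
        c≢0 = ℚₚ.pos⇒nonZero c
      c⁻¹ : ℚ
      c⁻¹ = ℚ.1/ c
      0<c⁻¹ : 0ℚ ℚ.< c⁻¹
      0<c⁻¹ = ℚₚ.positive⁻¹ c⁻¹ {{ℚₚ.1/pos⇒pos c}}
      eq : c ℚ.* (c⁻¹ ℚ.* ε) ≡ ε
      eq = ≡.trans (≡.sym (ℚₚ.*-assoc c c⁻¹ ε))
             (≡.trans (≡.cong (ℚ._* ε) (ℚₚ.*-inverseʳ c)) (ℚₚ.*-identityˡ ε))

    halve : ∀ ε → 0ℚ ℚ.< ε → ∃[ δ ] 0ℚ ℚ.< δ × δ ℚ.+ δ ≡ ε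
    halve ε 0<ε = let δ , 0<δ , eq = divide (1ℚ ℚ.+ 1ℚ) ε (+-pos 0<1 0<1) 0<ε in
      δ , 0<δ , ≡.trans (double δ) eq
      where
      double : ∀ δ → δ ℚ.+ δ ≡ (1ℚ ℚ.+ 1ℚ) ℚ.* δ
      double δ = ≡.sym (≡.trans (ℚₚ.*-distribʳ-+ δ 1ℚ 1ℚ)
                   (≡.cong₂ ℚ._+_ (ℚₚ.*-identityˡ δ) (ℚₚ.*-identityˡ δ)))

    thirds : ∀ ε → 0ℚ ℚ.< ε → ∃[ δ ] 0ℚ ℚ.< δ × (δ ℚ.+ δ) ℚ.+ δ ≡ ε
    thirds ε 0<ε = let δ , 0<δ , eq = divide (1ℚ ℚ.+ 1ℚ ℚ.+ 1ℚ) ε (+-pos (+-pos 0<1 0<1) 0<1) 0<ε in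
      δ , 0<δ , ≡.trans (triple δ) eq
      where
      triple : ∀ δ → (δ ℚ.+ δ) ℚ.+ δ ≡ (1ℚ ℚ.+ 1ℚ ℚ.+ 1ℚ) ℚ.* δ
      triple δ = solve 1 (λ d → d :+ d :+ d := (con 1ℚ :+ con 1ℚ :+ con 1ℚ) :* d) ≡.refl δ
        where open +-*-Solver

    ∣*∣-< : ∀ {a u A δ} → 0ℚ ℚ.< A → ∣ a ∣ ℚ.< A → ∣ u ∣ ℚ.< δ → ∣ a ℚ.* u ∣ ℚ.< A ℚ.* δ
    ∣*∣-< {a} {u} {A} {δ} 0<A a<A u<δ = begin-strict
      ∣ a ℚ.* u ∣      ≡⟨ ℚₚ.∣p*q∣≡∣p∣*∣q∣ a u ⟩
      ∣ a ∣ ℚ.* ∣ u ∣  ≤⟨ ℚₚ.*-monoʳ-≤-nonNeg ∣ u ∣ {{ℚₚ.∣-∣-nonNeg u}} (ℚₚ.<⇒≤ a<A) ⟩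
      A ℚ.* ∣ u ∣      <⟨ ℚₚ.*-monoʳ-<-pos A {{ℚ.positive 0<A}} u<δ ⟩
      A ℚ.* δ          ∎
      where open ℚₚ.≤-Reasoning

    sum-close : ∀ {a b c d δ} → ∣ a ℚ.- c ∣ ℚ.< δ → ∣ b ℚ.- d ∣ ℚ.< δ →
                ∣ (a ℚ.+ b) ℚ.- (c ℚ.+ d) ∣ ℚ.< δ ℚ.+ δ
    sum-close {a} {b} {c} {d} {δ} p q = begin-strict
      ∣ (a ℚ.+ b) ℚ.- (c ℚ.+ d) ∣    ≡⟨ ≡.cong ∣_∣ eq ⟩
      ∣ (a ℚ.- c) ℚ.+ (b ℚ.- d) ∣    ≤⟨ ℚₚ.∣p+q∣≤∣p∣+∣q∣ (a ℚ.- c) (b ℚ.- d) ⟩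
      ∣ a ℚ.- c ∣ ℚ.+ ∣ b ℚ.- d ∣    <⟨ ℚₚ.+-mono-< p q ⟩
      δ ℚ.+ δ                        ∎
      where
      open ℚₚ.≤-Reasoning
      open +-*-Solver
      eq : (a ℚ.+ b) ℚ.- (c ℚ.+ d) ≡ (a ℚ.- c) ℚ.+ (b ℚ.- d)
      eq = solve 4 (λ a b c d → (a :+ b) :- (c :+ d) := (a :- c) :+ (b :- d)) ≡.refl a b c d

    neg-close : ∀ {a b δ} → ∣ a ℚ.- b ∣ ℚ.< δ → ∣ (ℚ.- a) ℚ.- (ℚ.- b) ∣ ℚ.< δ
    neg-close {a} {b} {δ} p =
      ≡.subst (ℚ._< δ) (≡.trans (≡.sym (ℚₚ.∣-p∣≡∣p∣ (a ℚ.- b))) (≡.cong ∣_∣ eq)) p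
      where
      open +-*-Solver
      eq : ℚ.- (a ℚ.- b) ≡ (ℚ.- a) ℚ.- (ℚ.- b)
      eq = solve 2 (λ a b → :- (a :- b) := (:- a) :- (:- b)) ≡.refl a b

    product-close : ∀ {a b c d A D δ} → 0ℚ ℚ.< A → 0ℚ ℚ.< D →
                    ∣ a ∣ ℚ.< A → ∣ d ∣ ℚ.< D →
                    ∣ a ℚ.- c ∣ ℚ.< δ → ∣ b ℚ.- d ∣ ℚ.< δ →
                    ∣ (a ℚ.* b) ℚ.- (c ℚ.* d) ∣ ℚ.< (A ℚ.+ D) ℚ.* δ
    product-close {a} {b} {c} {d} {A} {D} {δ} 0<A 0<D a<A d<D p q = begin-strict
      ∣ (a ℚ.* b) ℚ.- (c ℚ.* d) ∣                      ≡⟨ ≡.cong ∣_∣ eq ⟩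
      ∣ a ℚ.* (b ℚ.- d) ℚ.+ d ℚ.* (a ℚ.- c) ∣          ≤⟨ ℚₚ.∣p+q∣≤∣p∣+∣q∣ (a ℚ.* (b ℚ.- d)) (d ℚ.* (a ℚ.- c)) ⟩
      ∣ a ℚ.* (b ℚ.- d) ∣ ℚ.+ ∣ d ℚ.* (a ℚ.- c) ∣      <⟨ ℚₚ.+-mono-< (∣*∣-< 0<A a<A q) (∣*∣-< 0<D d<D p) ⟩
      A ℚ.* δ ℚ.+ D ℚ.* δ                              ≡⟨ ℚₚ.*-distribʳ-+ δ A D ⟨
      (A ℚ.+ D) ℚ.* δ                                  ∎
      where
      open ℚₚ.≤-Reasoning
      open +-*-Solver
      eq : (a ℚ.* b) ℚ.- (c ℚ.* d) ≡ a ℚ.* (b ℚ.- d) ℚ.+ d ℚ.* (a ℚ.- c)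
      eq = solve 4 (λ a b c d → (a :* b) :- (c :* d) := a :* (b :- d) :+ d :* (a :- c)) ≡.refl a b c d

-- Reals are Cauchy sequences of rationals. N is data depending on ε, so _≈_
-- and _#_ are the usual constructive equality and apartness; x # 0ℝ is the
-- positive form of "x is nonzero", classically the same as ¬ x ≈ 0ℝ.
Cauchy : (ℕ → ℚ) → Set
Cauchy s = ∀ ε → 0ℚ ℚ.< ε →
  ∃[ N ] ∀ m n → N ℕ.≤ m → N ℕ.≤ n → ∣ s m ℚ.- s n ∣ ℚ.< ε

Eventually : (ℕ → Set) → Set
Eventually P = ∃[ N ] ∀ n → N ℕ.≤ n → P n

-- Without η, and with operations defined by copatterns, terms such as x + y
-- stay folded, which implicit arguments of the ring laws rely on.
record ℝ : Set where
  no-eta-equality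
  field
    seq    : ℕ → ℚ
    cauchy : Cauchy seq

open ℝ

infix 4 _≈_ _#_

record _≈_ (x y : ℝ) : Set where
  constructor mk≈
  field
    close : ∀ ε → 0ℚ ℚ.< ε → Eventually (λ n → ∣ seq x n ℚ.- seq y n ∣ ℚ.< ε)

open _≈_

record _#_ (x y : ℝ) : Set where
  constructor mk#
  field
    gap      : ℚ
    gap-pos  : 0ℚ ℚ.< gap
    separate : Eventually (λ n → gap ℚ.< ∣ seq x n ℚ.- seq y n ∣)

open _#_

private
  ev-map : ∀ {P Q : ℕ → Set} → (∀ n → P n → Q n) → Eventually P → Eventually Q
  ev-map f (N , p) = N , λ n N≤n → f n (p n N≤n)

  ev-map₂ : ∀ {P Q R : ℕ → Set} → (∀ n → P n → Q n → R n) →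
            Eventually P → Eventually Q → Eventually R
  ev-map₂ f (M , p) (N , q) = M ℕ.⊔ N , λ n M⊔N≤n →
    f n (p n (ℕₚ.m⊔n≤o⇒m≤o M N M⊔N≤n)) (q n (ℕₚ.m⊔n≤o⇒n≤o M N M⊔N≤n))

  ev-witness : ∀ {P : ℕ → Set} → Eventually P → ∃[ n ] P n
  ev-witness (N , p) = N , p N ℕₚ.≤-refl

  pointwise : ∀ {x y} → (∀ n → seq x n ≡ seq y n) → x ≈ y
  pointwise {x} {y} eq = mk≈ λ ε 0<ε → 0 , λ n _ →
    ≡.subst (λ t → ∣ seq x n ℚ.- t ∣ ℚ.< ε) (eq n)
      (≡.subst (ℚ._< ε) (≡.sym (∣p-p∣≡0 (seq x n))) 0<ε)

  opaque
    bounded : ∀ {s} → Cauchy s → ∃[ B ] 0ℚ ℚ.< B × Eventually (λ n → ∣ s n ∣ ℚ.< B)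
    bounded {s} c with c 1ℚ 0<1
    ... | N , p = B , ℚₚ.+-mono-≤-< (ℚₚ.0≤∣p∣ (s N)) 0<1 , N , bound
      where
      B : ℚ
      B = ∣ s N ∣ ℚ.+ 1ℚ
      bound : ∀ n → N ℕ.≤ n → ∣ s n ∣ ℚ.< B
      bound n N≤n = begin-strict
        ∣ s n ∣                                 ≡⟨ ≡.cong ∣_∣ (p-0≡p (s n)) ⟨
        ∣ s n ℚ.- 0ℚ ∣                          ≤⟨ triangle (s n) (s N) 0ℚ ⟩
        ∣ s n ℚ.- s N ∣ ℚ.+ ∣ s N ℚ.- 0ℚ ∣      ≡⟨ ≡.cong (λ t → ∣ s n ℚ.- s N ∣ ℚ.+ ∣ t ∣) (p-0≡p (s N)) ⟩
        ∣ s n ℚ.- s N ∣ ℚ.+ ∣ s N ∣             ≡⟨ ℚₚ.+-comm ∣ s n ℚ.- s N ∣ ∣ s N ∣ ⟩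
        ∣ s N ∣ ℚ.+ ∣ s n ℚ.- s N ∣             <⟨ ℚₚ.+-monoʳ-< ∣ s N ∣ (p n N N≤n ℕₚ.≤-refl) ⟩
        B                                       ∎
        where open ℚₚ.≤-Reasoning

    constant-cauchy : ∀ q → Cauchy (λ _ → q)
    constant-cauchy q ε 0<ε = 0 , λ _ _ _ _ → ≡.subst (ℚ._< ε) (≡.sym (∣p-p∣≡0 q)) 0<ε

    +-cauchy : ∀ {s t} → Cauchy s → Cauchy t → Cauchy (λ n → s n ℚ.+ t n)
    +-cauchy {s} {t} c d ε 0<ε with halve ε 0<ε
    ... | δ , 0<δ , eq with c δ 0<δ | d δ 0<δ
    ... | M , p | N , q = M ℕ.⊔ N , λ m n ≤m ≤n →
      ≡.subst (∣ (s m ℚ.+ t m) ℚ.- (s n ℚ.+ t n) ∣ ℚ.<_) eq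
        (sum-close {s m} {t m} {s n} {t n}
          (p m n (ℕₚ.m⊔n≤o⇒m≤o M N ≤m) (ℕₚ.m⊔n≤o⇒m≤o M N ≤n))
          (q m n (ℕₚ.m⊔n≤o⇒n≤o M N ≤m) (ℕₚ.m⊔n≤o⇒n≤o M N ≤n)))

    neg-cauchy : ∀ {s} → Cauchy s → Cauchy (λ n → ℚ.- s n)
    neg-cauchy {s} c ε 0<ε with c ε 0<ε
    ... | N , p = N , λ m n ≤m ≤n → neg-close {s m} {s n} (p m n ≤m ≤n)

    *-cauchy : ∀ {s t} → Cauchy s → Cauchy t → Cauchy (λ n → s n ℚ.* t n)
    *-cauchy {s} {t} c d ε 0<ε with bounded {s} c | bounded {t} d
    ... | A , 0<A , K , a | D , 0<D , L , b with divide (A ℚ.+ D) ε (+-pos 0<A 0<D) 0<ε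
    ... | δ , 0<δ , eq with c δ 0<δ | d δ 0<δ
    ... | M , p | N , q = (K ℕ.⊔ L) ℕ.⊔ (M ℕ.⊔ N) , λ m n ≤m ≤n →
      let KL = K ℕ.⊔ L ; MN = M ℕ.⊔ N
          KL≤m = ℕₚ.m⊔n≤o⇒m≤o KL MN ≤m ; MN≤m = ℕₚ.m⊔n≤o⇒n≤o KL MN ≤m
          KL≤n = ℕₚ.m⊔n≤o⇒m≤o KL MN ≤n ; MN≤n = ℕₚ.m⊔n≤o⇒n≤o KL MN ≤n
      in
      ≡.subst (∣ (s m ℚ.* t m) ℚ.- (s n ℚ.* t n) ∣ ℚ.<_) eq
        (product-close {s m} {t m} {s n} {t n} 0<A 0<D
          (a m (ℕₚ.m⊔n≤o⇒m≤o K L KL≤m)) (b n (ℕₚ.m⊔n≤o⇒n≤o K L KL≤n))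
          (p m n (ℕₚ.m⊔n≤o⇒m≤o M N MN≤m) (ℕₚ.m⊔n≤o⇒m≤o M N MN≤n))
          (q m n (ℕₚ.m⊔n≤o⇒n≤o M N MN≤m) (ℕₚ.m⊔n≤o⇒n≤o M N MN≤n)))

infix  8 -_
infixl 7 _*_
infixl 6 _+_ _-_

fromℚ : ℚ → ℝ
fromℚ q .seq    _ = q
fromℚ q .cauchy   = constant-cauchy q

0ℝ 1ℝ : ℝ
0ℝ = fromℚ 0ℚ
1ℝ = fromℚ 1ℚ

_+_ : ℝ → ℝ → ℝ
(x + y) .seq    n = seq x n ℚ.+ seq y n
(x + y) .cauchy   = +-cauchy {seq x} {seq y} (cauchy x) (cauchy y)

_*_ : ℝ → ℝ → ℝ
(x * y) .seq    n = seq x n ℚ.* seq y n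
(x * y) .cauchy   = *-cauchy {seq x} {seq y} (cauchy x) (cauchy y)

-_ : ℝ → ℝ
(- x) .seq    n = ℚ.- seq x n
(- x) .cauchy   = neg-cauchy {seq x} (cauchy x)

_-_ : ℝ → ℝ → ℝ
x - y = x + - y

private
  opaque
    ≈-refl : ∀ {x} → x ≈ x
    ≈-refl {x} = pointwise {x} {x} λ _ → ≡.refl

    ≈-sym : ∀ {x y} → x ≈ y → y ≈ x
    ≈-sym {x} {y} p = mk≈ λ ε 0<ε →
      ev-map (λ n → ≡.subst (ℚ._< ε) (∣-∣-swap (seq x n) (seq y n))) (close p ε 0<ε)

    ≈-trans : ∀ {x y z} → x ≈ y → y ≈ z → x ≈ z
    ≈-trans {x} {y} {z} p q = mk≈ λ ε 0<ε →
      let δ , 0<δ , eq = halve ε 0<ε in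
      ev-map₂ (λ n u v → ≡.subst (∣ seq x n ℚ.- seq z n ∣ ℚ.<_) eq
          (ℚₚ.≤-<-trans (triangle (seq x n) (seq y n) (seq z n)) (ℚₚ.+-mono-< u v)))
        (close p δ 0<δ) (close q δ 0<δ)

    +-cong : ∀ {x x′ y y′} → x ≈ x′ → y ≈ y′ → x + y ≈ x′ + y′
    +-cong {x} {x′} {y} {y′} p q = mk≈ λ ε 0<ε →
      let δ , 0<δ , eq = halve ε 0<ε in
      ev-map₂ (λ n u v → ≡.subst (∣ seq (x + y) n ℚ.- seq (x′ + y′) n ∣ ℚ.<_) eq
          (sum-close {seq x n} {seq y n} {seq x′ n} {seq y′ n} u v))
        (close p δ 0<δ) (close q δ 0<δ)

    neg-cong : ∀ {x y} → x ≈ y → - x ≈ - y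
    neg-cong {x} {y} p = mk≈ λ ε 0<ε →
      ev-map (λ n → neg-close {seq x n} {seq y n}) (close p ε 0<ε)

    *-cong : ∀ {x x′ y y′} → x ≈ x′ → y ≈ y′ → x * y ≈ x′ * y′
    *-cong {x} {x′} {y} {y′} p q = mk≈ λ ε 0<ε →
      let A , 0<A , a = bounded {seq x} (cauchy x)
          D , 0<D , d = bounded {seq y′} (cauchy y′)
          δ , 0<δ , eq = divide (A ℚ.+ D) ε (+-pos 0<A 0<D) 0<ε
      in
      ev-map₂ (λ n (a , d) (u , v) → ≡.subst (∣ seq (x * y) n ℚ.- seq (x′ * y′) n ∣ ℚ.<_) eq
          (product-close {seq x n} {seq y n} {seq x′ n} {seq y′ n} 0<A 0<D a d u v))
        (ev-map₂ (λ _ → _,_) a d) (ev-map₂ (λ _ → _,_) (close p δ 0<δ) (close q δ 0<δ))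

ℝ-commutativeRing : CommutativeRing 0ℓ 0ℓ
ℝ-commutativeRing = record
  { Carrier = ℝ ; _≈_ = _≈_ ; _+_ = _+_ ; _*_ = _*_ ; -_ = -_ ; 0# = 0ℝ ; 1# = 1ℝ
  ; isCommutativeRing = record
    { isRing = record
      { +-isAbelianGroup = record
        { isGroup = record
          { isMonoid = record
            { isSemigroup = record
              { isMagma = record
                { isEquivalence = record { refl = ≈-refl ; sym = ≈-sym ; trans = ≈-trans }
                ; ∙-cong = +-cong
                }
              ; assoc = λ x y z → pointwise λ n → ℚₚ.+-assoc (seq x n) (seq y n) (seq z n)
              }
            ; identity = (λ x → pointwise λ n → ℚₚ.+-identityˡ (seq x n))
                       , (λ x → pointwise λ n → ℚₚ.+-identityʳ (seq x n))
            }
          ; inverse = (λ x → pointwise λ n → ℚₚ.+-inverseˡ (seq x n))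
                    , (λ x → pointwise λ n → ℚₚ.+-inverseʳ (seq x n))
          ; ⁻¹-cong = neg-cong
          }
        ; comm = λ x y → pointwise λ n → ℚₚ.+-comm (seq x n) (seq y n)
        }
      ; *-cong = *-cong
      ; *-assoc = λ x y z → pointwise λ n → ℚₚ.*-assoc (seq x n) (seq y n) (seq z n)
      ; *-identity = (λ x → pointwise λ n → ℚₚ.*-identityˡ (seq x n))
                   , (λ x → pointwise λ n → ℚₚ.*-identityʳ (seq x n))
      ; distrib = (λ x y z → pointwise λ n → ℚₚ.*-distribˡ-+ (seq x n) (seq y n) (seq z n))
                , (λ x y z → pointwise λ n → ℚₚ.*-distribʳ-+ (seq x n) (seq y n) (seq z n))
      }
    ; *-comm = λ x y → pointwise λ n → ℚₚ.*-comm (seq x n) (seq y n)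
    }
  }

private
  -- The value at 0 is irrelevant: a sequence apart from 0 is eventually
  -- nonzero.
  recip : ℚ → ℚ
  recip q with q ℚₚ.≟ 0ℚ
  ... | yes _   = 0ℚ
  ... | no  q≢0 = ℚ.1/_ q {{ℚ.≢-nonZero q≢0}}

  opaque
    recip-inverseʳ : ∀ q → q ≢ 0ℚ → q ℚ.* recip q ≡ 1ℚ
    recip-inverseʳ q q≢0 with q ℚₚ.≟ 0ℚ
    ... | yes q≡0 = contradiction q≡0 q≢0
    ... | no  ≢0  = ℚₚ.*-inverseʳ q {{ℚ.≢-nonZero ≢0}}

    gap⇒≢0 : ∀ {ε q} → 0ℚ ℚ.< ε → ε ℚ.< ∣ q ∣ → q ≢ 0ℚ
    gap⇒≢0 0<ε ε<q ≡.refl = ℚₚ.<-asym 0<ε ε<q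

    recip-bound : ∀ {ε E q} → 0ℚ ℚ.< ε → ε ℚ.* E ≡ 1ℚ → ε ℚ.< ∣ q ∣ → ∣ recip q ∣ ℚ.≤ E
    recip-bound {ε} {E} {q} 0<ε εE≡1 ε<q = ℚₚ.*-cancelˡ-≤-pos ε {{ℚ.positive 0<ε}} (begin
      ε ℚ.* ∣ recip q ∣      ≤⟨ ℚₚ.*-monoʳ-≤-nonNeg ∣ recip q ∣ {{ℚₚ.∣-∣-nonNeg (recip q)}} (ℚₚ.<⇒≤ ε<q) ⟩
      ∣ q ∣ ℚ.* ∣ recip q ∣  ≡⟨ ℚₚ.∣p*q∣≡∣p∣*∣q∣ q (recip q) ⟨
      ∣ q ℚ.* recip q ∣      ≡⟨ ≡.cong ∣_∣ (recip-inverseʳ q (gap⇒≢0 0<ε ε<q)) ⟩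
      1ℚ                     ≡⟨ εE≡1 ⟨
      ε ℚ.* E                ∎)
      where open ℚₚ.≤-Reasoning

    recip-diff : ∀ p q → p ≢ 0ℚ → q ≢ 0ℚ →
                 recip p ℚ.- recip q ≡ (recip p ℚ.* recip q) ℚ.* (q ℚ.- p)
    recip-diff p q p≢0 q≢0 = ≡.sym (begin
      (p′ ℚ.* q′) ℚ.* (q ℚ.- p)
        ≡⟨ solve 4 (λ p q p′ q′ → (p′ :* q′) :* (q :- p) := p′ :* (q :* q′) :- q′ :* (p :* p′)) ≡.refl p q p′ q′ ⟩
      p′ ℚ.* (q ℚ.* q′) ℚ.- q′ ℚ.* (p ℚ.* p′)
        ≡⟨ ≡.cong₂ (λ a b → p′ ℚ.* a ℚ.- q′ ℚ.* b) (recip-inverseʳ q q≢0) (recip-inverseʳ p p≢0) ⟩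
      p′ ℚ.* 1ℚ ℚ.- q′ ℚ.* 1ℚ
        ≡⟨ ≡.cong₂ ℚ._-_ (ℚₚ.*-identityʳ p′) (ℚₚ.*-identityʳ q′) ⟩
      p′ ℚ.- q′ ∎)
      where
      open ≡-Reasoning
      open +-*-Solver
      p′ q′ : ℚ
      p′ = recip p
      q′ = recip q

    recip-cauchy : ∀ {x} → x # 0ℝ → Cauchy (λ n → recip (seq x n))
    recip-cauchy {x} (mk# ε 0<ε (M , sep)) η 0<η with divide ε 1ℚ 0<ε 0<1
    ... | E , 0<E , εE≡1 with divide (E ℚ.* E) η (*-pos 0<E 0<E) 0<η
    ... | δ , 0<δ , eq with cauchy x δ 0<δ
    ... | N , c = M ℕ.⊔ N , bound
      where
      open ℚₚ.≤-Reasoning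
      big : ∀ n → M ℕ.⊔ N ℕ.≤ n → ε ℚ.< ∣ seq x n ∣
      big n ≤n = ≡.subst (λ t → ε ℚ.< ∣ t ∣) (p-0≡p (seq x n)) (sep n (ℕₚ.m⊔n≤o⇒m≤o M N ≤n))
      bound : ∀ m n → M ℕ.⊔ N ℕ.≤ m → M ℕ.⊔ N ℕ.≤ n →
              ∣ recip (seq x m) ℚ.- recip (seq x n) ∣ ℚ.< η
      bound m n ≤m ≤n = begin-strict
        ∣ p′ ℚ.- q′ ∣                      ≡⟨ ≡.cong ∣_∣ (recip-diff p q (gap⇒≢0 0<ε (big m ≤m)) (gap⇒≢0 0<ε (big n ≤n))) ⟩
        ∣ (p′ ℚ.* q′) ℚ.* (q ℚ.- p) ∣      ≡⟨ ℚₚ.∣p*q∣≡∣p∣*∣q∣ (p′ ℚ.* q′) (q ℚ.- p) ⟩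
        ∣ p′ ℚ.* q′ ∣ ℚ.* ∣ q ℚ.- p ∣      ≡⟨ ≡.cong (ℚ._* ∣ q ℚ.- p ∣) (ℚₚ.∣p*q∣≡∣p∣*∣q∣ p′ q′) ⟩
        ∣ p′ ∣ ℚ.* ∣ q′ ∣ ℚ.* ∣ q ℚ.- p ∣  ≤⟨ ℚₚ.*-monoʳ-≤-nonNeg ∣ q ℚ.- p ∣ {{ℚₚ.∣-∣-nonNeg (q ℚ.- p)}} p′q′≤EE ⟩
        E ℚ.* E ℚ.* ∣ q ℚ.- p ∣            <⟨ ℚₚ.*-monoʳ-<-pos (E ℚ.* E) {{ℚ.positive (*-pos 0<E 0<E)}} q-p<δ ⟩
        E ℚ.* E ℚ.* δ                      ≡⟨ eq ⟩
        η                                  ∎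
        where
        p q p′ q′ : ℚ
        p = seq x m
        q = seq x n
        p′ = recip p
        q′ = recip q
        q-p<δ : ∣ q ℚ.- p ∣ ℚ.< δ
        q-p<δ = c n m (ℕₚ.m⊔n≤o⇒n≤o M N ≤n) (ℕₚ.m⊔n≤o⇒n≤o M N ≤m)
        p′q′≤EE : ∣ p′ ∣ ℚ.* ∣ q′ ∣ ℚ.≤ E ℚ.* E
        p′q′≤EE = begin
          ∣ p′ ∣ ℚ.* ∣ q′ ∣  ≤⟨ ℚₚ.*-monoʳ-≤-nonNeg ∣ q′ ∣ {{ℚₚ.∣-∣-nonNeg q′}} (recip-bound {q = p} 0<ε εE≡1 (big m ≤m)) ⟩
          E ℚ.* ∣ q′ ∣       ≤⟨ ℚₚ.*-monoˡ-≤-nonNeg E {{ℚₚ.pos⇒nonNeg E {{ℚ.positive 0<E}}}} (recip-bound {q = q} 0<ε εE≡1 (big n ≤n)) ⟩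
          E ℚ.* E            ∎

recipℝ : (x : ℝ) → x # 0ℝ → ℝ
recipℝ x x#0 .seq    n = recip (seq x n)
recipℝ x x#0 .cauchy   = recip-cauchy {x} x#0

opaque
  recipℝ-inverseʳ : ∀ x (x#0 : x # 0ℝ) → x * recipℝ x x#0 ≈ 1ℝ
  recipℝ-inverseʳ x x#0@(mk# ε 0<ε (M , sep)) = mk≈ λ η 0<η → M , λ n ≤n →
    ≡.subst (λ t → ∣ t ℚ.- 1ℚ ∣ ℚ.< η)
      (≡.sym (recip-inverseʳ (seq x n)
        (gap⇒≢0 0<ε (≡.subst (λ t → ε ℚ.< ∣ t ∣) (p-0≡p (seq x n)) (sep n ≤n)))))
      0<η

private
  module R = CommutativeRing ℝ-commutativeRing

  opaque
    #-irrefl : ∀ {x y} → x ≈ y → ¬ x # y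
    #-irrefl p (mk# ε 0<ε sep) =
      let _ , u , v = ev-witness (ev-map₂ (λ _ → _,_) (close p ε 0<ε) sep) in ℚₚ.<-asym u v

    #-sym : ∀ {x y} → x # y → y # x
    #-sym {x} {y} (mk# ε 0<ε sep) = mk# ε 0<ε
      (ev-map (λ n → ≡.subst (ε ℚ.<_) (∣-∣-swap (seq x n) (seq y n))) sep)

    -- If ∣x_N - y_N∣ ≥ 3δ and both sequences vary by less than δ beyond N,
    -- then ∣x_n - y_n∣ > δ beyond N.
    apart-from : ∀ x y δ → 0ℚ ℚ.< δ → ∀ N →
      (∀ n → N ℕ.≤ n → ∣ seq x N ℚ.- seq x n ∣ ℚ.< δ) →
      (∀ n → N ℕ.≤ n → ∣ seq y n ℚ.- seq y N ∣ ℚ.< δ) →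
      (δ ℚ.+ δ) ℚ.+ δ ℚ.≤ ∣ seq x N ℚ.- seq y N ∣ → x # y
    apart-from x y δ 0<δ N cx cy far = mk# δ 0<δ (N , sep)
      where
      open ℚₚ.≤-Reasoning
      sep : ∀ n → N ℕ.≤ n → δ ℚ.< ∣ seq x n ℚ.- seq y n ∣
      sep n N≤n = ℚₚ.≰⇒> λ near → ℚₚ.<-irrefl ≡.refl (ℚₚ.≤-<-trans far (begin-strict
        ∣ seq x N ℚ.- seq y N ∣
          ≤⟨ triangle (seq x N) (seq y n) (seq y N) ⟩
        ∣ seq x N ℚ.- seq y n ∣ ℚ.+ ∣ seq y n ℚ.- seq y N ∣
          ≤⟨ ℚₚ.+-monoˡ-≤ ∣ seq y n ℚ.- seq y N ∣ (triangle (seq x N) (seq x n) (seq y n)) ⟩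
        ∣ seq x N ℚ.- seq x n ∣ ℚ.+ ∣ seq x n ℚ.- seq y n ∣ ℚ.+ ∣ seq y n ℚ.- seq y N ∣
          <⟨ ℚₚ.+-mono-< (ℚₚ.+-mono-<-≤ (cx n N≤n) near) (cy n N≤n) ⟩
        δ ℚ.+ δ ℚ.+ δ ∎))

    cotrans-at : ∀ x y z δ → 0ℚ ℚ.< δ → ∀ P → let η = (δ ℚ.+ δ) ℚ.+ δ in
      (∀ m n → P ℕ.≤ m → P ℕ.≤ n → ∣ seq x m ℚ.- seq x n ∣ ℚ.< δ) →
      (∀ m n → P ℕ.≤ m → P ℕ.≤ n → ∣ seq y m ℚ.- seq y n ∣ ℚ.< δ) →
      (∀ m n → P ℕ.≤ m → P ℕ.≤ n → ∣ seq z m ℚ.- seq z n ∣ ℚ.< δ) →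
      η ℚ.+ η ℚ.< ∣ seq x P ℚ.- seq y P ∣ → x # z ⊎ z # y
    cotrans-at x y z δ 0<δ P cx cy cz far = choose (η ℚₚ.≤? xz) (η ℚₚ.≤? zy)
      where
      η xz zy : ℚ
      η = (δ ℚ.+ δ) ℚ.+ δ
      xz = ∣ seq x P ℚ.- seq z P ∣
      zy = ∣ seq z P ℚ.- seq y P ∣
      P≤P : P ℕ.≤ P
      P≤P = ℕₚ.≤-refl
      choose : Dec (η ℚ.≤ xz) → Dec (η ℚ.≤ zy) → x # z ⊎ z # y
      choose (yes η≤xz) _ = inj₁
        (apart-from x z δ 0<δ P (λ n → cx P n P≤P) (λ n P≤n → cz n P P≤n P≤P) η≤xz)
      choose (no _) (yes η≤zy) = inj₂
        (apart-from z y δ 0<δ P (λ n → cz P n P≤P) (λ n P≤n → cy n P P≤n P≤P) η≤zy)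
      choose (no η≰xz) (no η≰zy) = contradiction far (ℚₚ.<-asym
        (ℚₚ.≤-<-trans (triangle (seq x P) (seq z P) (seq y P))
          (ℚₚ.+-mono-< (ℚₚ.≰⇒> η≰xz) (ℚₚ.≰⇒> η≰zy))))

    #-cotrans : ∀ {x y} → x # y → ∀ z → x # z ⊎ z # y
    #-cotrans {x} {y} (mk# ε 0<ε (K , sep)) z =
      let η , 0<η , 2η≡ε = halve ε 0<ε
          δ , 0<δ , 3δ≡η = thirds η 0<η
          L , cx = cauchy x δ 0<δ
          M , cy = cauchy y δ 0<δ
          N , cz = cauchy z δ 0<δ
          P = (K ℕ.⊔ L) ℕ.⊔ (M ℕ.⊔ N)
          KL≤P = ℕₚ.m≤m⊔n (K ℕ.⊔ L) (M ℕ.⊔ N)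
          MN≤P = ℕₚ.m≤n⊔m (K ℕ.⊔ L) (M ℕ.⊔ N)
          L≤P = ℕₚ.≤-trans (ℕₚ.m≤n⊔m K L) KL≤P
          M≤P = ℕₚ.≤-trans (ℕₚ.m≤m⊔n M N) MN≤P
          N≤P = ℕₚ.≤-trans (ℕₚ.m≤n⊔m M N) MN≤P
          later : ∀ {A P} {Q : ℕ → ℕ → Set} → A ℕ.≤ P →
                  (∀ m n → A ℕ.≤ m → A ℕ.≤ n → Q m n) → ∀ m n → P ℕ.≤ m → P ℕ.≤ n → Q m n
          later = λ A≤P c m n P≤m P≤n → c m n (ℕₚ.≤-trans A≤P P≤m) (ℕₚ.≤-trans A≤P P≤n)
      in
      cotrans-at x y z δ 0<δ P (later L≤P cx) (later M≤P cy) (later N≤P cz)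
        (≡.subst (ℚ._< ∣ seq x P ℚ.- seq y P ∣)
          (≡.trans (≡.sym 2η≡ε) (≡.sym (≡.cong₂ ℚ._+_ 3δ≡η 3δ≡η)))
          (sep P (ℕₚ.≤-trans (ℕₚ.m≤m⊔n K L) KL≤P)))

    #-tight : ∀ {x y} → ¬ x # y → x ≈ y
    #-tight {x} {y} ¬x#y = mk≈ λ ε 0<ε →
      let δ , 0<δ , 3δ≡ε = thirds ε 0<ε
          M , cx = cauchy x δ 0<δ
          N , cy = cauchy y δ 0<δ
      in M ℕ.⊔ N , λ n ≤n →
        let M≤n = ℕₚ.m⊔n≤o⇒m≤o M N ≤n
            N≤n = ℕₚ.m⊔n≤o⇒n≤o M N ≤n
        in ℚₚ.≰⇒> λ far → ¬x#y (apart-from x y δ 0<δ n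
          (λ m n≤m → cx n m M≤n (ℕₚ.≤-trans M≤n n≤m))
          (λ m n≤m → cy m n (ℕₚ.≤-trans N≤n n≤m) N≤n)
          (≡.subst (ℚ._≤ ∣ seq x n ℚ.- seq y n ∣) (≡.sym 3δ≡ε) far))

    #⇒-#0 : ∀ {x y} → x # y → (x - y) # 0ℝ
    #⇒-#0 {x} {y} (mk# ε 0<ε sep) = mk# ε 0<ε
      (ev-map (λ n → ≡.subst (λ t → ε ℚ.< ∣ t ∣) (≡.sym (p-0≡p (seq x n ℚ.- seq y n)))) sep)

    rightInvertible⇒# : ∀ {x y} z → (x - y) * z ≈ 1ℝ → x # y
    rightInvertible⇒# {x} {y} z p with bounded {seq z} (cauchy z)
    ... | B , 0<B , b with divide B ½ 0<B (ℚₚ.positive⁻¹ ½)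
    ... | δ , 0<δ , Bδ≡½ = mk# δ 0<δ (ev-map₂ sep b (close p ½ (ℚₚ.positive⁻¹ ½)))
      where
      sep : ∀ n → ∣ seq z n ∣ ℚ.< B → ∣ (seq x n ℚ.- seq y n) ℚ.* seq z n ℚ.- 1ℚ ∣ ℚ.< ½ →
            δ ℚ.< ∣ seq x n ℚ.- seq y n ∣
      sep n c<B dc≈1 = ℚₚ.≰⇒> λ d≤δ → ℚₚ.<-irrefl ≡.refl (begin-strict
        1ℚ                                     ≤⟨ triangle 1ℚ (d ℚ.* c) 0ℚ ⟩
        ∣ 1ℚ ℚ.- d ℚ.* c ∣ ℚ.+ ∣ d ℚ.* c ℚ.- 0ℚ ∣
          ≡⟨ ≡.cong₂ ℚ._+_ (∣-∣-swap 1ℚ (d ℚ.* c)) (≡.cong ∣_∣ (p-0≡p (d ℚ.* c))) ⟩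
        ∣ d ℚ.* c ℚ.- 1ℚ ∣ ℚ.+ ∣ d ℚ.* c ∣     <⟨ ℚₚ.+-mono-<-≤ dc≈1 (dc≤½ d≤δ) ⟩
        ½ ℚ.+ ½                                ≡⟨⟩
        1ℚ                                     ∎)
        where
        open ℚₚ.≤-Reasoning
        d c : ℚ
        d = seq x n ℚ.- seq y n
        c = seq z n
        dc≤½ : ∣ d ∣ ℚ.≤ δ → ∣ d ℚ.* c ∣ ℚ.≤ ½
        dc≤½ d≤δ = begin
          ∣ d ℚ.* c ∣      ≡⟨ ℚₚ.∣p*q∣≡∣p∣*∣q∣ d c ⟩
          ∣ d ∣ ℚ.* ∣ c ∣  ≤⟨ ℚₚ.*-monoʳ-≤-nonNeg ∣ c ∣ {{ℚₚ.∣-∣-nonNeg c}} d≤δ ⟩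
          δ ℚ.* ∣ c ∣      ≤⟨ ℚₚ.*-monoˡ-≤-nonNeg δ {{ℚₚ.pos⇒nonNeg δ {{ℚ.positive 0<δ}}}} (ℚₚ.<⇒≤ c<B) ⟩
          δ ℚ.* B          ≡⟨ ℚₚ.*-comm δ B ⟩
          B ℚ.* δ          ≡⟨ Bδ≡½ ⟩
          ½                ∎

ℝ-heytingField : HeytingField 0ℓ 0ℓ 0ℓ
ℝ-heytingField = record
  { Carrier = ℝ ; _≈_ = _≈_ ; _#_ = _#_ ; _+_ = _+_ ; _*_ = _*_ ; -_ = -_ ; 0# = 0ℝ ; 1# = 1ℝ
  ; isHeytingField = record
    { isHeytingCommutativeRing = record
      { isCommutativeRing   = R.isCommutativeRing
      ; isApartnessRelation = record { irrefl = #-irrefl ; sym = #-sym ; cotrans = #-cotrans }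
      ; #⇒invertible = λ {x} {y} x#y →
          let d#0 = #⇒-#0 x#y ; inv = recipℝ-inverseʳ (x - y) d#0 in
          recipℝ (x - y) d#0 , R.trans (R.*-comm (recipℝ (x - y) d#0) (x - y)) inv , inv
      ; invertible⇒# = λ (z , _ , inv) → rightInvertible⇒# z inv
      }
    ; tight = λ x y → #-tight , #-irrefl
    }
  }

open import Algebra.Properties.Semiring.Exp R.semiring public using (_^_)
open import Algebra.Properties.Semiring.Sum R.semiring

∑₀ ∑₁ : ℕ → (ℕ → ℝ) → ℝ
∑₀ n f = sum {suc n} (λ i → f (toℕ i))
∑₁ n f = sum {n} (λ i → f (suc (toℕ i)))

syntax ∑₀ n (λ k → t) = ∑[0≤ k ≤ n ] t
syntax ∑₁ n (λ k → t) = ∑[1≤ k ≤ n ] t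
infixl 10 ∑₀ ∑₁

fromℕ : ℕ → ℝ
fromℕ n = fromℚ (+ n ℚ./ 1)

1/_! : ℕ → ℝ
1/ n ! = fromℚ ((+ 1 ℚ./ (n !)) {{n ℕₚ.!≢0}})

-- (x)_k
falling : ℝ → ℕ → ℝ
falling x zero    = 1ℝ
falling x (suc k) = falling x k * (x - fromℕ k)

-- (x)_{k,λ}
falling[_] : ℝ → ℝ → ℕ → ℝ
falling[ lam ] x zero    = 1ℝ
falling[ lam ] x (suc k) = falling[ lam ] x k * (x - fromℕ k * lam)

-- ⟨x⟩_{k,λ}
rising[_] : ℝ → ℝ → ℕ → ℝ
rising[ lam ] x zero    = 1ℝ
rising[ lam ] x (suc k) = rising[ lam ] x k * (x + fromℕ k * lam)

binomial : ℝ → ℕ → ℝ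
binomial x k = falling x k * 1/ k !

-- The defining expansion. It determines S n k for k ≤ n when lam # 0ℝ,
-- and leaves S n k unconstrained for k > n.
IsDegenerateStirling₁ : ℝ → (ℕ → ℕ → ℝ) → Set
IsDegenerateStirling₁ lam S =
  ∀ n x → falling x n ≈ ∑[0≤ k ≤ n ] (S n k * falling[ lam ] x k)

-- The triangular recurrence gives a family satisfying the expansion, for
-- every lam.
module _ (lam : ℝ) where

  degenerateStirling₁ : ℕ → ℕ → ℝ
  degenerateStirling₁ zero    zero    = 1ℝ
  degenerateStirling₁ zero    (suc k) = 0ℝ
  degenerateStirling₁ (suc n) zero    =
    (fromℕ 0 * lam - fromℕ n) * degenerateStirling₁ n 0
  degenerateStirling₁ (suc n) (suc k) =
    degenerateStirling₁ n k + (fromℕ (suc k) * lam - fromℕ n) * degenerateStirling₁ n (suc k)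

  private
    open import Algebra.Properties.CommutativeSemigroup R.+-commutativeSemigroup using () renaming (x∙yz≈y∙xz to x+yz≈y+xz)
    open import Relation.Binary.Reasoning.Setoid R.setoid

    S = degenerateStirling₁

    vanish : ∀ n k → n ℕ.< k → S n k ≈ 0ℝ
    vanish zero    (suc k) _           = R.refl
    vanish (suc n) (suc k) (ℕ.s≤s n<k) = begin
      S n k + c * S n (suc k)  ≈⟨ R.+-cong (vanish n k n<k) (R.*-congˡ (vanish n (suc k) (ℕₚ.m≤n⇒m≤1+n n<k))) ⟩
      0ℝ + c * 0ℝ              ≈⟨ R.+-identityˡ _ ⟩
      c * 0ℝ                   ≈⟨ R.zeroʳ c ⟩
      0ℝ                       ∎
      where c = fromℕ (suc k) * lam - fromℕ n

    ∑₀-cong : ∀ n {f g} → (∀ k → f k ≈ g k) → ∑₀ n f ≈ ∑₀ n g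
    ∑₀-cong n eq = sum-cong-≋ {suc n} (λ i → eq (toℕ i))

    ∑₀-last : ∀ n f → ∑₀ (suc n) f ≈ ∑₀ n f + f (suc n)
    ∑₀-last zero f = begin
      f 0 + (f 1 + 0ℝ)  ≈⟨ R.+-assoc _ _ _ ⟨
      f 0 + f 1 + 0ℝ    ≈⟨ R.+-identityʳ _ ⟩
      f 0 + f 1         ≈⟨ R.+-congʳ (R.+-identityʳ _) ⟨
      f 0 + 0ℝ + f 1    ∎
    ∑₀-last (suc n) f = begin
      f 0 + ∑₀ (suc n) (λ k → f (suc k))              ≈⟨ R.+-congˡ (∑₀-last n (λ k → f (suc k))) ⟩
      f 0 + (∑₀ n (λ k → f (suc k)) + f (suc (suc n)))  ≈⟨ R.+-assoc _ _ _ ⟨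
      f 0 + ∑₀ n (λ k → f (suc k)) + f (suc (suc n))    ∎

    split : ∀ x a b → x - b ≈ (x - a) + (a - b)
    split x a b = R.sym (begin
      (x - a) + (a - b)    ≈⟨ R.+-assoc x (- a) (a - b) ⟩
      x + (- a + (a - b))  ≈⟨ R.+-congˡ (R.+-assoc (- a) a (- b)) ⟨
      x + (- a + a - b)    ≈⟨ R.+-congˡ (R.+-congʳ (R.-‿inverseˡ a)) ⟩
      x + (0ℝ - b)         ≈⟨ R.+-congˡ (R.+-identityˡ (- b)) ⟩
      x - b                ∎)

  degenerateStirling₁-is : IsDegenerateStirling₁ lam degenerateStirling₁
  degenerateStirling₁-is zero    x = R.sym (R.trans (R.+-identityʳ _) (R.*-identityˡ _))
  degenerateStirling₁-is (suc n) x = begin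
    falling x n * (x - fromℕ n)
      ≈⟨ R.*-congʳ (degenerateStirling₁-is n x) ⟩
    ∑₀ n (λ k → S n k * P k) * (x - fromℕ n)
      ≈⟨ *-distribʳ-sum {suc n} (x - fromℕ n) (λ i → S n (toℕ i) * P (toℕ i)) ⟩
    ∑₀ n (λ k → S n k * P k * (x - fromℕ n))
      ≈⟨ ∑₀-cong n step ⟩
    ∑₀ n (λ k → S n k * P (suc k) + g k)
      ≈⟨ ∑-distrib-+ {suc n} (λ i → S n (toℕ i) * P (suc (toℕ i))) (λ i → g (toℕ i)) ⟩
    A + ∑₀ n g
      ≈⟨ R.+-congˡ (R.+-identityʳ _) ⟨
    A + (∑₀ n g + 0ℝ)
      ≈⟨ R.+-congˡ (R.+-congˡ g-last) ⟨
    A + (∑₀ n g + g (suc n))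
      ≈⟨ R.+-congˡ (∑₀-last n g) ⟨
    A + (g 0 + ∑₀ n (λ k → g (suc k)))
      ≈⟨ x+yz≈y+xz A (g 0) _ ⟩
    g 0 + (A + ∑₀ n (λ k → g (suc k)))
      ≈⟨ R.+-congˡ (∑-distrib-+ {suc n} (λ i → S n (toℕ i) * P (suc (toℕ i))) (λ i → g (suc (toℕ i)))) ⟨
    g 0 + ∑₀ n (λ k → S n k * P (suc k) + g (suc k))
      ≈⟨ R.+-congˡ (∑₀-cong n (λ k → R.distribʳ (P (suc k)) (S n k) (c (suc k) * S n (suc k)))) ⟨
    ∑₀ (suc n) (λ k → S (suc n) k * P k) ∎
    where
    P = falling[ lam ] x
    c g : ℕ → ℝ
    c k = fromℕ k * lam - fromℕ n
    g k = c k * S n k * P k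
    A = ∑₀ n (λ k → S n k * P (suc k))

    step : ∀ k → S n k * P k * (x - fromℕ n) ≈ S n k * P (suc k) + g k
    step k = begin
      S n k * P k * (x - fromℕ n)
        ≈⟨ R.*-congˡ (split x (fromℕ k * lam) (fromℕ n)) ⟩
      S n k * P k * ((x - fromℕ k * lam) + c k)
        ≈⟨ R.distribˡ (S n k * P k) (x - fromℕ k * lam) (c k) ⟩
      S n k * P k * (x - fromℕ k * lam) + S n k * P k * c k
        ≈⟨ R.+-cong (R.*-assoc (S n k) (P k) (x - fromℕ k * lam)) (R.*-comm (S n k * P k) (c k)) ⟩
      S n k * P (suc k) + c k * (S n k * P k)
        ≈⟨ R.+-congˡ (R.*-assoc (c k) (S n k) (P k)) ⟨
      S n k * P (suc k) + g k ∎

    g-last : g (suc n) ≈ 0ℝ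
    g-last = begin
      c (suc n) * S n (suc n) * P (suc n)  ≈⟨ R.*-congʳ (R.*-congˡ (vanish n (suc n) ℕₚ.≤-refl)) ⟩
      c (suc n) * 0ℝ * P (suc n)           ≈⟨ R.*-congʳ (R.zeroʳ (c (suc n))) ⟩
      0ℝ * P (suc n)                       ≈⟨ R.zeroˡ (P (suc n)) ⟩
      0ℝ                                   ∎

-- H_{n,λ}
harmonic : (lam : ℝ) → lam # 0ℝ → ℕ → ℝ
harmonic lam lam#0 n =
  ∑[1≤ k ≤ n ] (recipℝ lam lam#0 * binomial lam k * (- 1ℝ) ^ (k ∸ 1))

-- H_{n,λ}^{(r)}, for r ≥ 1
hyperharmonic : (lam : ℝ) → lam # 0ℝ → (r : ℕ) → .{{NonZero r}} → ℕ → ℝ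
hyperharmonic lam lam#0 (suc zero)    n = harmonic lam lam#0 n
hyperharmonic lam lam#0 (suc (suc r)) n =
  ∑[1≤ k ≤ n ] (hyperharmonic lam lam#0 (suc r) k)

{-# OPTIONS --safe #-}

-- The λ-difference of the degenerate falling factorial is
-- (x + λ)_{k,λ} − (x)_{k,λ} = k λ (x)_{k−1,λ}, and (−1)^k ⟨r⟩_{k,λ} = (−r)_{k,λ}.
-- Evaluating the expansion that defines S₁ at x = λ − r and at x = −r and
-- subtracting therefore turns the right-hand side into
--   (−1)^n (C(−r, n) − C(λ − r, n)) / λ.
-- By Pascal's rule the partial sums of (−1)^k C(x, k) are (−1)^n C(x − 1, n),
-- so this closed form obeys the same summation recursion in r as the
-- hyperharmonic numbers.
module Submission where

open import Defs
open import Algebra.Bundles using (CommutativeRing)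
open import Data.Fin.Base using (toℕ)
open import Data.Fin.Properties using (toℕ<n)
open import Data.Integer.Base as ℤ using (+_)
open import Data.Integer.Solver using () renaming (module +-*-Solver to ℤ-Solver)
open import Data.Nat.Base as ℕ using (ℕ; zero; suc; _!; NonZero; _∸_)
import Data.Nat.Properties as ℕₚ
open import Data.Nat.Solver using () renaming (module +-*-Solver to ℕ-Solver)
open import Data.Product.Base using (_×_; _,_)
open import Data.Rational.Base as ℚ using (0ℚ; 1ℚ; ∣_∣; toℚᵘ)
import Data.Rational.Properties as ℚₚ
open import Data.Rational.Solver using (module +-*-Solver)
open import Data.Rational.Unnormalised.Base as ℚᵘ using (*≡*)
import Data.Rational.Unnormalised.Properties as ℚᵘₚ
open import Relation.Binary.PropositionalEquality.Core as ≡ using (_≡_)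

open ℝ

private
  module R = CommutativeRing ℝ-commutativeRing

open import Algebra.Properties.CommutativeSemigroup R.*-commutativeSemigroup using (xy∙z≈xz∙y)
open import Algebra.Properties.Semiring.Exp R.semiring using (^-homo-*)
open import Algebra.Properties.Semiring.Sum R.semiring using (sum-cong-≋; ∑-distrib-+; *-distribˡ-sum)

-- Reduces ring identities in ℝ to ring identities in ℚ, where the solver applies.
pointwise : ∀ {x y} → (∀ n → seq x n ≡ seq y n) → x ≈ y
pointwise {x} {y} eq = mk≈ λ ε 0<ε → 0 , λ n _ →
  ≡.subst (λ t → ∣ seq x n ℚ.- t ∣ ℚ.< ε) (eq n)
    (≡.subst (ℚ._< ε) (≡.sym (≡.cong ∣_∣ (ℚₚ.+-inverseʳ (seq x n)))) 0<ε)

-- Numerals and reciprocal factorials.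

-- `ℚ._/_` cancels common factors and is stuck on variables, so fraction identities are checked on
-- unnormalised fractions, where they become integer equations.
toℚᵘ-/ : ∀ i d .{{_ : NonZero d}} → toℚᵘ (i ℚ./ d) ℚᵘ.≃ i ℚᵘ./ d
toℚᵘ-/ i (suc d) = ℚₚ.toℚᵘ-fromℚᵘ (i ℚᵘ./ suc d)

suc/1 : ∀ n → + suc n ℚ./ 1 ≡ + n ℚ./ 1 ℚ.+ 1ℚ
suc/1 n = ℚₚ.toℚᵘ-injective (begin-equality
  toℚᵘ (+ suc n ℚ./ 1)           ≃⟨ toℚᵘ-/ (+ suc n) 1 ⟩
  + suc n ℚᵘ./ 1                 ≃⟨ *≡* (eq (+ n)) ⟩
  + n ℚᵘ./ 1 ℚᵘ.+ ℚᵘ.1ℚᵘ         ≃⟨ ℚᵘₚ.+-congˡ ℚᵘ.1ℚᵘ (toℚᵘ-/ (+ n) 1) ⟨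
  toℚᵘ (+ n ℚ./ 1) ℚᵘ.+ toℚᵘ 1ℚ  ≃⟨ ℚₚ.toℚᵘ-homo-+ (+ n ℚ./ 1) 1ℚ ⟨
  toℚᵘ (+ n ℚ./ 1 ℚ.+ 1ℚ)        ∎)
  where
  open ℚᵘₚ.≤-Reasoning
  open ℤ-Solver
  eq : ∀ i → (+ 1 ℤ.+ i) ℤ.* + 1 ≡ (i ℤ.* + 1 ℤ.+ + 1) ℤ.* + 1
  eq = solve 1 (λ i → (con (+ 1) :+ i) :* con (+ 1) := (i :* con (+ 1) :+ con (+ 1)) :* con (+ 1)) ≡.refl

1/[m*n]*m : ∀ m n .{{_ : NonZero m}} .{{_ : NonZero n}} .{{_ : NonZero (m ℕ.* n)}} →
            + 1 ℚ./ (m ℕ.* n) ℚ.* (+ m ℚ./ 1) ≡ + 1 ℚ./ n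
1/[m*n]*m m@(suc _) n@(suc _) = ℚₚ.toℚᵘ-injective (begin-equality
  toℚᵘ (+ 1 ℚ./ (m ℕ.* n) ℚ.* (+ m ℚ./ 1))         ≃⟨ ℚₚ.toℚᵘ-homo-* (+ 1 ℚ./ (m ℕ.* n)) (+ m ℚ./ 1) ⟩
  toℚᵘ (+ 1 ℚ./ (m ℕ.* n)) ℚᵘ.* toℚᵘ (+ m ℚ./ 1)   ≃⟨ ℚᵘₚ.*-cong (toℚᵘ-/ (+ 1) (m ℕ.* n)) (toℚᵘ-/ (+ m) 1) ⟩
  (+ 1 ℚᵘ./ (m ℕ.* n)) ℚᵘ.* (+ m ℚᵘ./ 1)           ≃⟨ *≡* (≡.cong +_ (eq m n)) ⟩
  + 1 ℚᵘ./ n                                       ≃⟨ toℚᵘ-/ (+ 1) n ⟨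
  toℚᵘ (+ 1 ℚ./ n)                                 ∎)
  where
  open ℚᵘₚ.≤-Reasoning
  open ℕ-Solver
  eq : ∀ m n → (1 ℕ.* m) ℕ.* n ≡ 1 ℕ.* ((m ℕ.* n) ℕ.* 1)
  eq = solve 2 (λ m n → (con 1 :* m) :* n := con 1 :* ((m :* n) :* con 1)) ≡.refl

fromℕ-suc : ∀ n → fromℕ (suc n) ≈ fromℕ n + 1ℝ
fromℕ-suc n = pointwise λ _ → suc/1 n

1/[1+n]!*[1+n] : ∀ n → 1/ (suc n) ! * fromℕ (suc n) ≈ 1/ n !
1/[1+n]!*[1+n] n = pointwise λ _ →
  1/[m*n]*m (suc n) (n !) {{_}} {{n ℕₚ.!≢0}} {{suc n ℕₚ.!≢0}}

open import Relation.Binary.Reasoning.Setoid R.setoid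
open +-*-Solver using (solve; con; _:+_; _:*_; _:-_; :-_; _:=_)

-- Telescoping sums and signs.

∑₁-telescope : ∀ n (f F : ℕ → ℝ) → (∀ k → F (suc k) ≈ F k + f (suc k)) →
               ∑₁ n f ≈ F n - F 0
∑₁-telescope zero    f F step = R.sym (R.-‿inverseʳ (F 0))
∑₁-telescope (suc n) f F step = begin
  f 1 + ∑₁ n (λ k → f (suc k))
    -- `sum` peels off its first term, so the induction runs on the shifted `f` and `F`, with lower
    -- end `F 1`.
    ≈⟨ R.+-congˡ (∑₁-telescope n (λ k → f (suc k)) (λ k → F (suc k)) (λ k → step (suc k))) ⟩
  f 1 + (F (suc n) - F 1)
    ≈⟨ R.+-congˡ (R.+-congˡ (R.-‿cong (step 0))) ⟩
  f 1 + (F (suc n) - (F 0 + f 1))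
    ≈⟨ pointwise (λ m → solve 3 (λ a b c → a :+ (b :- (c :+ a)) := b :- c) ≡.refl
         (seq (f 1) m) (seq (F (suc n)) m) (seq (F 0) m)) ⟩
  F (suc n) - F 0 ∎

sgn : ℕ → ℝ
sgn n = (- 1ℝ) ^ n

sgn-square : ∀ n → sgn n * sgn n ≈ 1ℝ
sgn-square zero    = R.*-identityˡ 1ℝ
sgn-square (suc n) = begin
  (- 1ℝ * sgn n) * (- 1ℝ * sgn n)
    ≈⟨ pointwise (λ m → solve 1 (λ s → (:- con 1ℚ :* s) :* (:- con 1ℚ :* s) := s :* s) ≡.refl (seq (sgn n) m)) ⟩
  sgn n * sgn n ≈⟨ sgn-square n ⟩
  1ℝ            ∎

-- Degenerate falling and rising factorials.

-- After the leading factor `x`, the factors are those of `y`, as x - (j + 1) h = y - j h. Factors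
-- are appended on the right, so splitting off the leading one takes an induction.
falling-shift : ∀ h {x y} → x ≈ y + h → ∀ k →
                falling[ h ] x (suc k) ≈ x * falling[ h ] y k
falling-shift h {x} {y} x≈y+h zero =
  pointwise λ m → solve 2 (λ x h → con 1ℚ :* (x :- con 0ℚ :* h) := x :* con 1ℚ) ≡.refl (seq x m) (seq h m)
falling-shift h {x} {y} x≈y+h (suc k) = begin
  falling[ h ] x (suc k) * (x - fromℕ (suc k) * h)
    ≈⟨ R.*-cong (falling-shift h x≈y+h k) (R.+-cong x≈y+h (R.-‿cong (R.*-congʳ (fromℕ-suc k)))) ⟩
  x * falling[ h ] y k * ((y + h) - (fromℕ k + 1ℝ) * h)
    ≈⟨ pointwise (λ m → solve 5 (λ x p y h k → x :* p :* ((y :+ h) :- (k :+ con 1ℚ) :* h)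
           := x :* (p :* (y :- k :* h))) ≡.refl
         (seq x m) (seq (falling[ h ] y k) m) (seq y m) (seq h m) (seq (fromℕ k) m)) ⟩
  x * (falling[ h ] y k * (y - fromℕ k * h)) ∎

-- The leading factor y + h is (y - k h) + (k + 1) h, and y - k h is the next factor of the product
-- for `y`.
falling-difference : ∀ h {x y} → x ≈ y + h → ∀ k →
  falling[ h ] x (suc k) ≈ falling[ h ] y (suc k) + fromℕ (suc k) * h * falling[ h ] y k
falling-difference h {x} {y} x≈y+h k = begin
  falling[ h ] x (suc k)
    ≈⟨ falling-shift h x≈y+h k ⟩
  x * p
    ≈⟨ R.*-congʳ x≈y+h ⟩
  (y + h) * p
    ≈⟨ pointwise (λ m → solve 4 (λ y h p k → (y :+ h) :* p
           := p :* (y :- k :* h) :+ (k :+ con 1ℚ) :* h :* p) ≡.refl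
         (seq y m) (seq h m) (seq p m) (seq (fromℕ k) m)) ⟩
  p * (y - fromℕ k * h) + (fromℕ k + 1ℝ) * h * p
    ≈⟨ R.+-congˡ (R.*-congʳ (R.*-congʳ (fromℕ-suc k))) ⟨
  p * (y - fromℕ k * h) + fromℕ (suc k) * h * p ∎
  where p = falling[ h ] y k

falling≈falling[1] : ∀ x n → falling x n ≈ falling[ 1ℝ ] x n
falling≈falling[1] x zero    = R.refl
falling≈falling[1] x (suc n) =
  R.*-cong (falling≈falling[1] x n) (R.+-congˡ (R.-‿cong (R.sym (R.*-identityʳ (fromℕ n)))))

falling[-x]≈sgn*rising : ∀ h x k → falling[ h ] (- x) k ≈ sgn k * rising[ h ] x k
falling[-x]≈sgn*rising h x zero    = R.sym (R.*-identityˡ 1ℝ)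
falling[-x]≈sgn*rising h x (suc k) = begin
  falling[ h ] (- x) k * (- x - fromℕ k * h)
    ≈⟨ R.*-congʳ (falling[-x]≈sgn*rising h x k) ⟩
  sgn k * rising[ h ] x k * (- x - fromℕ k * h)
    ≈⟨ pointwise (λ m → solve 5 (λ s p x k h → s :* p :* (:- x :- k :* h)
           := (:- con 1ℚ :* s) :* (p :* (x :+ k :* h))) ≡.refl
         (seq (sgn k) m) (seq (rising[ h ] x k) m) (seq x m) (seq (fromℕ k) m) (seq h m)) ⟩
  sgn (suc k) * rising[ h ] x (suc k) ∎

-- For k < n the subtraction is not truncated, so (-1)^(n-k-1) = -(-1)^n (-1)^k, and (-1)^k turns
-- the rising factorial into a falling one at `- x`.
sgn*rising≈falling : ∀ h x {k n} → k ℕ.< n →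
  sgn (n ∸ suc k) * rising[ h ] x k ≈ - (sgn n * falling[ h ] (- x) k)
sgn*rising≈falling h x {k} {n} k<n = begin
  s * p
    ≈⟨ R.trans (R.*-congˡ (sgn-square k)) (R.*-identityʳ (s * p)) ⟨
  s * p * (t * t)
    ≈⟨ pointwise (λ m → solve 3 (λ s p t → s :* p :* (t :* t)
           := :- ((s :* (:- con 1ℚ :* t)) :* (t :* p))) ≡.refl (seq s m) (seq p m) (seq t m)) ⟩
  - ((s * sgn (suc k)) * (t * p))
    ≈⟨ R.-‿cong (R.*-congˡ (falling[-x]≈sgn*rising h x k)) ⟨
  - ((s * sgn (suc k)) * falling[ h ] (- x) k)
    ≈⟨ R.-‿cong (R.*-congʳ (^-homo-* (- 1ℝ) (n ∸ suc k) (suc k))) ⟨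
  - (sgn (n ∸ suc k ℕ.+ suc k) * falling[ h ] (- x) k)
    ≡⟨ ≡.cong (λ m → - (sgn m * falling[ h ] (- x) k)) (ℕₚ.m∸n+n≡m k<n) ⟩
  - (sgn n * falling[ h ] (- x) k) ∎
  where
  s = sgn (n ∸ suc k)
  t = sgn k
  p = rising[ h ] x k

-- Pascal's rule and signed binomials.

-- This is Pascal's rule multiplied by (n + 1)!, obtained from the degenerate difference with step
-- 1.
falling-pascal : ∀ {x y} → x ≈ y + 1ℝ → ∀ n →
  falling x (suc n) ≈ falling y (suc n) + fromℕ (suc n) * falling y n
falling-pascal {x} {y} x≈y+1 n = begin
  falling x (suc n)
    ≈⟨ falling≈falling[1] x (suc n) ⟩
  falling[ 1ℝ ] x (suc n)
    ≈⟨ falling-difference 1ℝ x≈y+1 n ⟩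
  falling[ 1ℝ ] y (suc n) + fromℕ (suc n) * 1ℝ * falling[ 1ℝ ] y n
    ≈⟨ R.+-cong (falling≈falling[1] y (suc n))
         (R.*-cong (R.sym (R.*-identityʳ (fromℕ (suc n)))) (falling≈falling[1] y n)) ⟨
  falling y (suc n) + fromℕ (suc n) * falling y n ∎

falling-0 : ∀ n → falling 0ℝ (suc n) ≈ 0ℝ
falling-0 n = begin
  falling 0ℝ (suc n)              ≈⟨ falling≈falling[1] 0ℝ (suc n) ⟩
  falling[ 1ℝ ] 0ℝ (suc n)        ≈⟨ falling-shift 1ℝ (R.sym (R.-‿inverseˡ 1ℝ)) n ⟩
  0ℝ * falling[ 1ℝ ] (- 1ℝ) n     ≈⟨ R.zeroˡ _ ⟩
  0ℝ                              ∎

-- The coefficient of t^n in (1 - t)^x. Lowering `x` by 1 divides the series by 1 - t, which sums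
-- coefficients.
signedBinomial : ℝ → ℕ → ℝ
signedBinomial x n = sgn n * binomial x n

signedBinomial-pascal : ∀ {x y} → x ≈ y + 1ℝ → ∀ n →
  signedBinomial y (suc n) ≈ signedBinomial y n + signedBinomial x (suc n)
signedBinomial-pascal {x} {y} x≈y+1 n = begin
  sgn (suc n) * (q * d)
    -- The product of `s`, `p`, `d` and `N` is added and subtracted: `q + N * p` is the falling
    -- factorial of `x`, and `d * N` is 1/n!.
    ≈⟨ pointwise (λ m → solve 5 (λ s p q N d → (:- con 1ℚ :* s) :* (q :* d)
           := s :* (p :* (d :* N)) :+ (:- con 1ℚ :* s) :* ((q :+ N :* p) :* d)) ≡.refl
         (seq (sgn n) m) (seq p m) (seq q m) (seq N m) (seq d m)) ⟩
  sgn n * (p * (d * N)) + sgn (suc n) * ((q + N * p) * d)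
    ≈⟨ R.+-cong (R.*-congˡ (R.*-congˡ (R.sym (1/[1+n]!*[1+n] n)))) (R.*-congˡ (R.*-congʳ (falling-pascal x≈y+1 n))) ⟨
  signedBinomial y n + signedBinomial x (suc n) ∎
  where
  p = falling y n
  q = falling y (suc n)
  N = fromℕ (suc n)
  d = 1/ (suc n) !

-- The sums start at k = 1, so each telescopes only up to its term at 0. That term does not depend
-- on the argument and cancels in the difference.
∑₁-signedBinomial-difference : ∀ c {x x′ y y′} → x ≈ y + 1ℝ → x′ ≈ y′ + 1ℝ → ∀ n →
  ∑[1≤ k ≤ n ] (c * (signedBinomial x k - signedBinomial x′ k))
    ≈ c * (signedBinomial y n - signedBinomial y′ n)
∑₁-signedBinomial-difference c {x} {x′} {y} {y′} x≈y+1 x′≈y′+1 n = begin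
  ∑[1≤ k ≤ n ] (c * (signedBinomial x k - signedBinomial x′ k))
    ≈⟨ ∑₁-telescope n f F step ⟩
  F n - F 0
    ≈⟨ pointwise (λ m → solve 3 (λ a c b → a :- c :* (b :- b) := a) ≡.refl
         (seq (F n) m) (seq c m) (seq (signedBinomial y 0) m)) ⟩
  F n ∎
  where
  f F : ℕ → ℝ
  f k = c * (signedBinomial x k - signedBinomial x′ k)
  F k = c * (signedBinomial y k - signedBinomial y′ k)
  step : ∀ k → F (suc k) ≈ F k + f (suc k)
  step k = begin
    F (suc k)
      ≈⟨ R.*-congˡ (R.+-cong (signedBinomial-pascal x≈y+1 k) (R.-‿cong (signedBinomial-pascal x′≈y′+1 k))) ⟩
    c * ((signedBinomial y k + signedBinomial x (suc k)) - (signedBinomial y′ k + signedBinomial x′ (suc k)))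
      ≈⟨ pointwise (λ m → solve 5 (λ c a b a′ b′ → c :* ((a :+ b) :- (a′ :+ b′))
             := c :* (a :- a′) :+ c :* (b :- b′)) ≡.refl
           (seq c m) (seq (signedBinomial y k) m) (seq (signedBinomial x (suc k)) m)
           (seq (signedBinomial y′ k) m) (seq (signedBinomial x′ (suc k)) m)) ⟩
    F k + f (suc k) ∎

-- Closed form of the hyperharmonic numbers.

module _ (lam : ℝ) (lam#0 : lam # 0ℝ) where

  private
    μ : ℝ
    μ = recipℝ lam lam#0

  -- Induction on `r`. Even the base case is a summation step: for k at least 1, C(0, k) = 0, so the
  -- summand of `harmonic` is the closed form at order 0.
  hyperharmonic-closed : ∀ r n → hyperharmonic lam lam#0 (suc r) n
    ≈ μ * (signedBinomial (- fromℕ (suc r)) n - signedBinomial (lam - fromℕ (suc r)) n)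
  hyperharmonic-closed zero n = begin
    ∑[1≤ k ≤ n ] (μ * binomial lam k * sgn (k ∸ 1))
      ≈⟨ sum-cong-≋ {n} (λ i → term (toℕ i)) ⟩
    ∑[1≤ k ≤ n ] (μ * (signedBinomial 0ℝ k - signedBinomial lam k))
      ≈⟨ ∑₁-signedBinomial-difference μ (R.sym (R.-‿inverseˡ 1ℝ))
           (pointwise (λ m → solve 1 (λ x → x := (x :- con 1ℚ) :+ con 1ℚ) ≡.refl (seq lam m))) n ⟩
    μ * (signedBinomial (- fromℕ 1) n - signedBinomial (lam - fromℕ 1) n) ∎
    where
    term : ∀ k → μ * binomial lam (suc k) * sgn k ≈ μ * (signedBinomial 0ℝ (suc k) - signedBinomial lam (suc k))
    term k = begin
      μ * binomial lam (suc k) * sgn k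
        ≈⟨ pointwise (λ m → solve 4 (λ c b s d → c :* b :* s
               := c :* ((:- con 1ℚ :* s) :* (con 0ℚ :* d) :- (:- con 1ℚ :* s) :* b)) ≡.refl
             (seq μ m) (seq (binomial lam (suc k)) m) (seq (sgn k) m) (seq (1/ (suc k) !) m)) ⟩
      μ * (sgn (suc k) * (0ℝ * 1/ (suc k) !) - signedBinomial lam (suc k))
        ≈⟨ R.*-congˡ (R.+-congʳ (R.*-congˡ (R.*-congʳ (falling-0 k)))) ⟨
      μ * (signedBinomial 0ℝ (suc k) - signedBinomial lam (suc k)) ∎
  hyperharmonic-closed (suc r) n = begin
    ∑[1≤ k ≤ n ] (hyperharmonic lam lam#0 (suc r) k)
      ≈⟨ sum-cong-≋ {n} (λ i → hyperharmonic-closed r (suc (toℕ i))) ⟩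
    ∑[1≤ k ≤ n ] (μ * (signedBinomial (- fromℕ (suc r)) k - signedBinomial (lam - fromℕ (suc r)) k))
      ≈⟨ ∑₁-signedBinomial-difference μ
           -- The shift for `- fromℕ (suc r)` is `shift` at 0 with the zeros removed.
           (R.trans (R.sym (R.+-identityˡ _)) (R.trans (shift 0ℝ) (R.+-congʳ (R.+-identityˡ _)))) (shift lam) n ⟩
    μ * (signedBinomial (- fromℕ (suc (suc r))) n - signedBinomial (lam - fromℕ (suc (suc r))) n) ∎
    where
    shift : ∀ x → x - fromℕ (suc r) ≈ (x - fromℕ (suc (suc r))) + 1ℝ
    shift x = begin
      x - fromℕ (suc r)
        ≈⟨ pointwise (λ m → solve 2 (λ x k → x :- k := (x :- (k :+ con 1ℚ)) :+ con 1ℚ) ≡.refl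
             (seq x m) (seq (fromℕ (suc r)) m)) ⟩
      (x - (fromℕ (suc r) + 1ℝ)) + 1ℝ
        ≈⟨ R.+-congʳ (R.+-congˡ (R.-‿cong (fromℕ-suc (suc r)))) ⟨
      (x - fromℕ (suc (suc r))) + 1ℝ ∎

  -- Closed form of the Stirling sum.

  module _ (S₁ : ℕ → ℕ → ℝ) (isStirling : IsDegenerateStirling₁ lam S₁) where

    stirling-difference : ∀ {x y} → x ≈ y + lam → ∀ n →
      falling x n ≈ falling y n + ∑[1≤ k ≤ n ] (S₁ n k * (fromℕ k * lam * falling[ lam ] y (k ∸ 1)))
    stirling-difference {x} {y} x≈y+lam n = begin
      falling x n
        ≈⟨ isStirling n x ⟩
      -- The term k = 0 is constant in the argument, so it passes unchanged from `x` to `y`.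
      S₁ n 0 * 1ℝ + ∑[1≤ k ≤ n ] (S₁ n k * falling[ lam ] x k)
        ≈⟨ R.+-congˡ (sum-cong-≋ {n} (λ i → R.trans
             (R.*-congˡ (falling-difference lam x≈y+lam (toℕ i))) (R.distribˡ (S₁ n (suc (toℕ i))) _ _))) ⟩
      S₁ n 0 * 1ℝ + ∑[1≤ k ≤ n ] (A k + B k)
        ≈⟨ R.+-congˡ (∑-distrib-+ {n} (λ i → A (suc (toℕ i))) (λ i → B (suc (toℕ i)))) ⟩
      S₁ n 0 * 1ℝ + (∑₁ n A + ∑₁ n B)
        ≈⟨ R.+-assoc _ _ _ ⟨
      S₁ n 0 * 1ℝ + ∑₁ n A + ∑₁ n B
        ≈⟨ R.+-congʳ (isStirling n y) ⟨
      falling y n + ∑₁ n B ∎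
      where
      A B : ℕ → ℝ
      A k = S₁ n k * falling[ lam ] y k
      B k = S₁ n k * (fromℕ k * lam * falling[ lam ] y (k ∸ 1))

    stirling-sum-closed : ∀ x n →
      1/ n ! * (∑[1≤ k ≤ n ] (sgn (n ∸ k) * rising[ lam ] x (k ∸ 1) * fromℕ k * S₁ n k))
        ≈ μ * (signedBinomial (- x) n - signedBinomial (lam - x) n)
    stirling-sum-closed x n = begin
      d * ∑₁ n T
        ≈⟨ R.*-congˡ (R.*-identityˡ (∑₁ n T)) ⟨
      d * (1ℝ * ∑₁ n T)
        -- Inserting `lam * μ`, which is 1, gives the summands the factor k λ of the λ-difference
        -- and leaves `μ` in front.
        ≈⟨ R.*-congˡ (R.*-congʳ (recipℝ-inverseʳ lam lam#0)) ⟨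
      d * (lam * μ * ∑₁ n T)
        ≈⟨ pointwise (λ m → solve 4 (λ d l c t → d :* (l :* c :* t) := d :* (c :* (l :* t))) ≡.refl
             (seq d m) (seq lam m) (seq μ m) (seq (∑₁ n T) m)) ⟩
      d * (μ * (lam * ∑₁ n T))
        ≈⟨ R.*-congˡ (R.*-congˡ (*-distribˡ-sum {n} lam (λ i → T (suc (toℕ i))))) ⟩
      d * (μ * ∑[1≤ k ≤ n ] (lam * T k))
        ≈⟨ R.*-congˡ (R.*-congˡ (sum-cong-≋ {n} (λ i → term (toℕ i) (toℕ<n i)))) ⟩
      d * (μ * ∑[1≤ k ≤ n ] (- sgn n * B k))
        ≈⟨ R.*-congˡ (R.*-congˡ (*-distribˡ-sum {n} (- sgn n) (λ i → B (suc (toℕ i))))) ⟨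
      d * (μ * (- sgn n * ∑₁ n B))
        -- Adding and subtracting `p` prepares `p + b`, the expansion of the falling factorial at
        -- `lam - x`.
        ≈⟨ pointwise (λ m → solve 5 (λ d c s b p → d :* (c :* (:- s :* b))
               := c :* (s :* (p :* d) :- s :* ((p :+ b) :* d))) ≡.refl
             (seq d m) (seq μ m) (seq (sgn n) m) (seq (∑₁ n B) m) (seq (falling (- x) n) m)) ⟩
      μ * (signedBinomial (- x) n - sgn n * ((falling (- x) n + ∑₁ n B) * d))
        ≈⟨ R.*-congˡ (R.+-congˡ (R.-‿cong (R.*-congˡ (R.*-congʳ
             (stirling-difference (R.+-comm lam (- x)) n))))) ⟨
      μ * (signedBinomial (- x) n - signedBinomial (lam - x) n) ∎
      where
      d = 1/ n !
      T B : ℕ → ℝ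
      T k = sgn (n ∸ k) * rising[ lam ] x (k ∸ 1) * fromℕ k * S₁ n k
      B k = S₁ n k * (fromℕ k * lam * falling[ lam ] (- x) (k ∸ 1))
      term : ∀ k → k ℕ.< n → lam * T (suc k) ≈ - sgn n * B (suc k)
      term k k<n = begin
        lam * (sgn (n ∸ suc k) * rising[ lam ] x k * fromℕ (suc k) * S₁ n (suc k))
          ≈⟨ R.*-congˡ (R.*-congʳ (R.*-congʳ (sgn*rising≈falling lam x k<n))) ⟩
        lam * (- (sgn n * p) * fromℕ (suc k) * S₁ n (suc k))
          ≈⟨ pointwise (λ m → solve 5 (λ l s p k t → l :* (:- (s :* p) :* k :* t)
                 := :- s :* (t :* (k :* l :* p))) ≡.refl
               (seq lam m) (seq (sgn n) m) (seq p m) (seq (fromℕ (suc k)) m) (seq (S₁ n (suc k)) m)) ⟩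
        - sgn n * B (suc k) ∎
        where p = falling[ lam ] (- x) k

theorem3 : (lam : ℝ) (lam#0 : lam # 0ℝ) (S₁ : ℕ → ℕ → ℝ) → IsDegenerateStirling₁ lam S₁ →
    ((n r : ℕ) .{{_ : NonZero n}} .{{_ : NonZero r}} →
    hyperharmonic lam lam#0 r n
    ≈ 1/ n ! * (∑[1≤ k ≤ n ] ((- 1ℝ) ^ (n ∸ k) * rising[ lam ] (fromℕ r) (k ∸ 1) * fromℕ k * S₁ n k)))
    × ((n : ℕ) .{{_ : NonZero n}} →
    harmonic lam lam#0 n
    ≈ 1/ n ! * (∑[1≤ k ≤ n ] ((- 1ℝ) ^ (n ∸ k) * fromℕ k * rising[ lam ] 1ℝ (k ∸ 1) * S₁ n k)))
theorem3 lam lam#0 S₁ isStirling = hyper , λ n → R.trans (hyper n 1) (R.*-congˡ (sum-cong-≋ {n} λ i → let k = toℕ i in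
    -- At r = 1 only the order of the factors differs; `fromℕ 1` computes to `1ℝ`.
    R.*-congʳ (xy∙z≈xz∙y (sgn (n ∸ suc k)) (rising[ lam ] 1ℝ k) (fromℕ (suc k)))))
  where
  hyper : (n r : ℕ) .{{_ : NonZero n}} .{{_ : NonZero r}} →
    hyperharmonic lam lam#0 r n
      ≈ 1/ n ! * (∑[1≤ k ≤ n ] (sgn (n ∸ k) * rising[ lam ] (fromℕ r) (k ∸ 1) * fromℕ k * S₁ n k))
  hyper n (suc r) = R.trans (hyperharmonic-closed lam lam#0 r n)
    (R.sym (stirling-sum-closed lam lam#0 S₁ isStirling (fromℕ (suc r)) n))
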